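{- Let $\mathcal G$ be a Petri game with one system player whose underlying net is finite and bounded. If Player~0 has a winning strategy in $\mathit{Graph}(\mathcal G)$, then Player~0 has a winning strategy in $\mathit{Graph}'(\mathcal G)$.
   Context: Petri nets. A Petri net is a tuple $\mathcal N=(\mathcal P,\mathcal T,\mathcal F,\mathit{In})$ where the set of places $\mathcal P$ and the set of transitions $\mathcal T$ are disjoint, the flow relation $\mathcal F$ is a multiset over $(\mathcal P\times\mathcal T)\cup(\mathcal T\times\mathcal P)$, and the initial marking $\mathit{In}$ is a finite multiset over $\mathcal P$. For a node $x$, the precondition ${}^\bullet x$ is the multiset with ${}^\bullet x(y)=\mathcal F(y,x)$ and the postcondition $x^\bullet$ is the multiset with $x^\bullet(y)=\mathcal F(x,y)$; every transition $t$ must satisfy $0<|{}^\bullet t|<\infty$ and $0<|t^\bullet|<\infty$. A marking is a finite multiset over $\mathcal P$. A transition $t$ is enabled in a marking $M$ if ${}^\bullet t\subseteq M$ (multiset inclusion); firing it yields $M'=M-{}^\bullet t+t^\bullet$, written $M\xrightarrow{t}M'$. A marking is reachable if it is obtained from $\mathit{In}$ by firing a finite sequence of transitions; $\mathcal R(\mathcal N)$ denotes the set of reachable markings. $\mathcal N$ is finite if $\mathcal P\cup\mathcal T$ is finite, $k$-bounded if $M(p)\le k$ for all $M\in\mathcal R(\mathcal N)$ and places $p$, bounded if $k$-bounded for some $k$. Multiset difference is truncated at $0$; $+$ is multiset sum. Petri games. A Petri game is $\mathcal G=(\mathcal P_S,\mathcal P_E,\mathcal T,\mathcal F,\mathit{In},\mathcal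 B)$ where $\mathcal P_S$ (system places) and $\mathcal P_E$ (environment places) are disjoint, $\mathcal N=(\mathcal P_S\cup\mathcal P_E,\mathcal T,\mathcal F,\mathit{In})$ is a finite Petri net (the underlying net) and $\mathcal B$ is a set of markings (bad markings). A transition $t$ is purely environmental if ${}^\bullet t\subseteq\mathcal P_E$, otherwise it is a system transition. $\mathcal G$ has one system player if every $M\in\mathcal R(\mathcal N)$ contains exactly one token on system places; that place is denoted $s_M$, and $s_M^\bullet$ is the set of transitions having $s_M$ in their precondition. Graph games. A graph game $(\mathcal V_0,\mathcal V_1,\mathcal I,\mathcal E,\mathcal X)$ has disjoint vertex sets $\mathcal V_0,\mathcal V_1$ (of Players 0 and 1), initial vertex $\mathcal I$, edge relation $\mathcal E$ and bad vertices $\mathcal X$. A play is a maximal (finite or infinite) sequence $v_0v_1\dots$ with $v_0=\mathcal I$ and $(v_i,v_{i+1})\in\mathcal E$; it is won by Player~0 if no $v_i\in\mathcal X$. A strategy for Player~0 is a vertex-labeled tree whose root is labeled $\mathcal I$, where a node labeled with a $\mathcal V_1$ vertex has one child for each successor vertex and a node labeled with a $\mathcal V_0$ vertex having a successor has exactly one child labeled with one successor; it is winning if all maximal paths are labeled with plays won by Player~0. The game $\mathit{Graph}(\mathcal G)$: $\mathcal V_0=\{(M,\top)\mid M\in\mathcal R(\mathcal N)\}$, $\mathcal V_1=\{(M,c)\mid M\in\mathcal R(\mathcal N),\,c\subseteq s_M^\bullet\}$, $\mathcal I=(\mathit{In},\top)$. Edges: (E1) $(M,\top)\to(M,c)$ for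 every $c\subseteq s_M^\bullet$; (E2) $(M,c)\to(M',c)$ whenever some purely environmental $\mathbf t$ satisfies $M\xrightarrow{\mathbf t}M'$; (E3) $(M,c)\to(M',\top)$ whenever some system transition $\mathbf t\in c$ satisfies $M\xrightarrow{\mathbf t}M'$. Bad vertices: all $(M,c)\in\mathcal V_1$ such that (X1) $M\in\mathcal B$; or (X2a) two distinct transitions of $c$ are enabled in $M$; or (X2b) some $\mathbf t\in c$ is enabled in $M$ and $0<{}^\bullet\mathbf t(p)<M(p)$ for some place $p$; or (X3) some transition is enabled in $M$, every transition enabled in $M$ is a system transition, and no transition enabled in $M$ lies in $c$. The game $\mathit{Graph}'(\mathcal G)$: $\mathcal V'_0=\{(M,\top,\{s_M\})\mid M\in\mathcal R(\mathcal N)\}$, $\mathcal V'_1=\{(M,c,R)\mid M\in\mathcal R(\mathcal N),\,c\subseteq s_M^\bullet,\,R$ a multiset with $s_M\in R\subseteq M\}$, $\mathcal I'=(\mathit{In},\top,\{s_{\mathit{In}}\})$. Edges: (E'1) $(M,\top,\{s_M\})\to(M,c,\{s_M\})$ for every $c\subseteq s_M^\bullet$; (E'2) $(M,c,R)\to(M',c,R')$ whenever some purely environmental $\mathbf t$ satisfies $M\xrightarrow{\mathbf t}M'$ and $R'=R-{}^\bullet\mathbf t+\{o\}$ for some place $o\in\mathbf t^\bullet$; (E'3) $(M,c,R)\to(M',\top,\{s_{M'}\})$ whenever some system transition $\mathbf t\in c$ satisfies $M\xrightarrow{\mathbf t}M'$ and $R\subseteq{}^\bullet\mathbf t$. Bad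 vertices: all $(M,c,R)\in\mathcal V'_1$ such that $(M,c)$ satisfies one of the conditions (X1), (X2a), (X2b), (X3) above. -}

module Defs where

open import Data.Bool using (true; false; if_then_else_)
open import Data.Empty using (⊥)
open import Data.Fin using (Fin; zero; suc; inject₁; fromℕ) renaming (_≟_ to _≟ᶠ_)
open import Data.Fin.Subset using (Subset; _∈_; _∉_)
open import Data.Maybe using (Maybe; just; nothing)
open import Data.Nat using (ℕ; zero; suc; _+_; _∸_; _≤_; _<_; z≤n; s≤s)
open import Data.Nat.Properties using (≤-trans; +-mono-≤; ∸-monoˡ-≤; m≤m+n; m≤n+m; suc-injective; n≤0⇒n≡0; ≮⇒≥; m+n≡0⇒n≡0; n≮0)
open import Data.Product using (Σ; _×_; _,_; proj₁; proj₂; ∃; ∃!)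
open import Data.Sum using (_⊎_; inj₁; inj₂)
open import Data.Vec using (Vec; []; _∷_; lookup; tabulate; zipWith; replicate; sum; _[_]≔_; here; there)
open import Data.Vec.Properties using (lookup-zipWith; lookup∘update; lookup∘update′; lookup-replicate)
open import Relation.Binary.PropositionalEquality using (_≡_; _≢_; refl; cong; subst)
open import Relation.Nullary using (¬_; yes; no; contradiction)

-- Multisets over Fin n are vectors of multiplicities, so that _≡_ is multiset
-- equality (functions Fin n → ℕ would need extensionality).

Multiset : ℕ → Set
Multiset n = Vec ℕ n

module _ {n : ℕ} where

  infix 4 _∈ₘ_ _⊆ₘ_
  infixl 6 _+ₘ_ _-ₘ_

  _∈ₘ_ : Fin n → Multiset n → Set
  p ∈ₘ M = 0 < lookup M p

  _⊆ₘ_ : Multiset n → Multiset n → Set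
  M ⊆ₘ M′ = ∀ p → lookup M p ≤ lookup M′ p

  _+ₘ_ _-ₘ_ : Multiset n → Multiset n → Multiset n
  _+ₘ_ = zipWith _+_
  _-ₘ_ = zipWith _∸_

  ∣_∣ₘ : Multiset n → ℕ
  ∣ M ∣ₘ = sum M

  ⁅_⁆ₘ : Fin n → Multiset n
  ⁅ p ⁆ₘ = replicate n 0 [ p ]≔ 1

  tokensOn : Subset n → Multiset n → ℕ
  tokensOn S M = sum (zipWith (λ b k → if b then k else 0) S M)

singleton-⊆ : ∀ {n} (M : Multiset n) {p} → p ∈ₘ M → ⁅ p ⁆ₘ ⊆ₘ M
singleton-⊆ {n} M {p} p∈M q with q ≟ᶠ p
... | yes refl rewrite lookup∘update p (replicate n 0) 1 = p∈M
... | no q≢p rewrite lookup∘update′ q≢p (replicate n 0) 1 | lookup-replicate q 0 = z≤n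

∈-singleton : ∀ {n} (p : Fin n) → p ∈ₘ ⁅ p ⁆ₘ
∈-singleton {n} p rewrite lookup∘update p (replicate n 0) 1 = s≤s z≤n

-- The first marked place of S; theToken-∈ and theToken-unique show that it is the only one.

theToken : ∀ {n} (S : Subset n) (M : Multiset n) → .(tokensOn S M ≡ 1) → Fin n
theToken []          []          ()
theToken (false ∷ S) (_     ∷ M) eq = suc (theToken S M eq)
theToken (true  ∷ S) (zero  ∷ M) eq = suc (theToken S M eq)
theToken (true  ∷ S) (suc _ ∷ M) eq = zero

theToken-∈ : ∀ {n} (S : Subset n) (M : Multiset n) (eq : tokensOn S M ≡ 1) →
             theToken S M eq ∈ S × theToken S M eq ∈ₘ M
theToken-∈ []          []          ()
theToken-∈ (false ∷ S) (_     ∷ M) eq with theToken-∈ S M eq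
... | s∈S , s∈M = there s∈S , s∈M
theToken-∈ (true  ∷ S) (zero  ∷ M) eq with theToken-∈ S M eq
... | s∈S , s∈M = there s∈S , s∈M
theToken-∈ (true  ∷ S) (suc _ ∷ M) eq = here , s≤s z≤n

lookup≤tokensOn : ∀ {n} (S : Subset n) (M : Multiset n) {p} → p ∈ S → lookup M p ≤ tokensOn S M
lookup≤tokensOn (true  ∷ S) (x ∷ M) here        = m≤m+n x _
lookup≤tokensOn (true  ∷ S) (x ∷ M) (there p∈S) = ≤-trans (lookup≤tokensOn S M p∈S) (m≤n+m _ x)
lookup≤tokensOn (false ∷ S) (x ∷ M) (there p∈S) = lookup≤tokensOn S M p∈S

theToken-unique : ∀ {n} (S : Subset n) (M : Multiset n) (eq : tokensOn S M ≡ 1) {p} →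
                  p ∈ S → p ∈ₘ M → p ≡ theToken S M eq
theToken-unique (false ∷ S) (_     ∷ M) eq (there p∈S) p∈M = cong suc (theToken-unique S M eq p∈S p∈M)
theToken-unique (true  ∷ S) (zero  ∷ M) eq (there p∈S) p∈M = cong suc (theToken-unique S M eq p∈S p∈M)
theToken-unique (true  ∷ S) (suc _ ∷ M) eq here        p∈M = refl
theToken-unique (true  ∷ S) (suc x ∷ M) eq {suc p} (there p∈S) p∈M = contradiction
  (subst (0 <_) (m+n≡0⇒n≡0 x (suc-injective eq)) (≤-trans p∈M (lookup≤tokensOn S M p∈S))) n≮0

-- Finiteness of ∣ pre t ∣ₘ and ∣ post t ∣ₘ is automatic over finitely many places.

record FinitePetriNet : Set where
  field
    #places #transitions : ℕ

  Place : Set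
  Place = Fin #places

  Transition : Set
  Transition = Fin #transitions

  Marking : Set
  Marking = Multiset #places

  field
    flow    : (Place × Transition) ⊎ (Transition × Place) → ℕ
    initial : Marking

  pre : Transition → Multiset #places
  pre = λ t → tabulate λ p → flow (inj₁ (p , t))

  post : Transition → Multiset #places
  post = λ t → tabulate λ p → flow (inj₂ (t , p))

  field
    pre-nonempty  : ∀ t → 0 < ∣ pre  t ∣ₘ
    post-nonempty : ∀ t → 0 < ∣ post t ∣ₘ

  Enabled : Marking → Transition → Set
  Enabled M t = pre t ⊆ₘ M

  infix 4 _[_⟩_
  _[_⟩_ : Marking → Transition → Marking → Set
  M [ t ⟩ M′ = Enabled M t × M′ ≡ M -ₘ pre t +ₘ post t

  data Reachable : Marking → Set where
    start : Reachable initial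
    fire  : ∀ {M t M′} → Reachable M → M [ t ⟩ M′ → Reachable M′

  IsBoundedBy : ℕ → Set
  IsBoundedBy k = ∀ {M} → Reachable M → ∀ p → lookup M p ≤ k

  Bounded : Set
  Bounded = ∃ IsBoundedBy

-- The environment places are the complement of the system places.

record PetriGame : Set₁ where
  field
    net : FinitePetriNet

  open FinitePetriNet net public

  field
    system : Subset #places
    bad    : Marking → Set

  PurelyEnvironmental : Transition → Set
  PurelyEnvironmental t = ∀ p → p ∈ₘ pre t → p ∉ system

  SystemTransition : Transition → Set
  SystemTransition t = ¬ PurelyEnvironmental t

  OneSystemPlayer : Set
  OneSystemPlayer = ∀ {M} → Reachable M → tokensOn system M ≡ 1

-- Finite sequences are nonempty: finite n f has the n + 1 entries f 0, …, f n.

data Sequence (A : Set) : Set where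
  finite   : (n : ℕ) → (Fin (suc n) → A) → Sequence A
  infinite : (ℕ → A) → Sequence A

mapˢ : {A B : Set} → (A → B) → Sequence A → Sequence B
mapˢ g (finite n f) = finite n (λ i → g (f i))
mapˢ g (infinite f) = infinite (λ i → g (f i))

Allˢ : {A : Set} → (A → Set) → Sequence A → Set
Allˢ P (finite n f) = ∀ i → P (f i)
Allˢ P (infinite f) = ∀ i → P (f i)

IsMaximalPath : {A : Set} → (A → A → Set) → A → Sequence A → Set
IsMaximalPath R a (finite n f) =
  f zero ≡ a × (∀ i → R (f (inject₁ i)) (f (suc i))) × ¬ ∃ (R (f (fromℕ n)))
IsMaximalPath R a (infinite f) =
  f 0 ≡ a × (∀ i → R (f i) (f (suc i)))

record GraphGame : Set₁ where
  field
    Vertex   : Set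
    V₀ V₁    : Vertex → Set
    disjoint : ∀ {v} → V₀ v → V₁ v → ⊥

  V : Vertex → Set
  V v = V₀ v ⊎ V₁ v

  field
    I   : Vertex
    E   : Vertex → Vertex → Set
    X   : Vertex → Set
    I⊆V : V I
    E⊆V : ∀ {v w} → E v w → V v × V w
    X⊆V : ∀ {v} → X v → V v

  IsPlay : Sequence Vertex → Set
  IsPlay = IsMaximalPath E I

  WonByPlayer0 : Sequence Vertex → Set
  WonByPlayer0 = Allˢ (λ v → ¬ X v)

-- A rooted tree given by its levels: Node n is the set of nodes at depth n.

record LabelledTree (L : Set) : Set₁ where
  field
    Node        : ℕ → Set
    root        : Node 0
    root-unique : ∀ x → x ≡ root
    parent      : ∀ {n} → Node (suc n) → Node n
    label       : ∀ {n} → Node n → L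

  _IsChildOf_ : ∀ {n} → Node (suc n) → Node n → Set
  y IsChildOf x = parent y ≡ x

  data _⟶_ : ∃ Node → ∃ Node → Set where
    child : ∀ {n} {x : Node n} {y} → y IsChildOf x → (n , x) ⟶ (suc n , y)

  labelAt : ∃ Node → L
  labelAt (_ , x) = label x

  IsMaximalTreePath : Sequence (∃ Node) → Set
  IsMaximalTreePath = IsMaximalPath _⟶_ (0 , root)

module _ (Γ : GraphGame) where
  open GraphGame Γ

  record Strategy : Set₁ where
    field
      tree : LabelledTree Vertex

    open LabelledTree tree public

    field
      root-label  : label root ≡ I
      child-label : ∀ {n} {x : Node n} {y} → y IsChildOf x → E (label x) (label y)
      player1     : ∀ {n} (x : Node n) → V₁ (label x) → ∀ w → E (label x) w →
                    ∃! _≡_ λ y → y IsChildOf x × label y ≡ w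
      player0     : ∀ {n} (x : Node n) → V₀ (label x) → ∃ (E (label x)) →
                    ∃! _≡_ λ y → y IsChildOf x

  IsWinning : Strategy → Set
  IsWinning σ = ∀ π → IsMaximalTreePath π →
                IsPlay (mapˢ labelAt π) × WonByPlayer0 (mapˢ labelAt π)
    where open Strategy σ

  Player0HasWinningStrategy : Set₁
  Player0HasWinningStrategy = Σ Strategy IsWinning

module _ (G : PetriGame) (one : PetriGame.OneSystemPlayer G) where
  open PetriGame G

  -- The place s_M; independent of the reachability proof by irrelevance.
  sysPlace : (M : Marking) → .(Reachable M) → Place
  sysPlace M r = theToken system M (one r)

  Commitment : Set
  Commitment = Subset #transitions

  _⊆_• : Commitment → Place → Set
  c ⊆ s • = ∀ {t} → t ∈ c → s ∈ₘ pre t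

  data BadCondition (M : Marking) (c : Commitment) : Set where
    X1  : bad M → BadCondition M c
    X2a : ∀ {t t′} → t ≢ t′ → t ∈ c → t′ ∈ c → Enabled M t → Enabled M t′ → BadCondition M c
    X2b : ∀ {t} p → t ∈ c → Enabled M t →
          0 < lookup (pre t) p → lookup (pre t) p < lookup M p → BadCondition M c
    X3  : ∃ (Enabled M) →
          (∀ t → Enabled M t → SystemTransition t) →
          (∀ t → Enabled M t → t ∉ c) → BadCondition M c

  sysPlace-stable : ∀ {M M′ t} (r : Reachable M) (f : M [ t ⟩ M′) → PurelyEnvironmental t →
                    sysPlace M r ≡ sysPlace M′ (fire r f)
  sysPlace-stable {M} {t = t} r f@(_ , refl) env =
    theToken-unique system _ (one (fire r f)) s∈S s∈M′
    where
    s = sysPlace M r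
    s∈S = proj₁ (theToken-∈ system M (one r))
    s∈M = proj₂ (theToken-∈ system M (one r))
    pre≡0 : lookup (pre t) s ≡ 0
    pre≡0 = n≤0⇒n≡0 (≮⇒≥ λ s∈pre → env s s∈pre s∈S)
    s∈M′ : s ∈ₘ (M -ₘ pre t +ₘ post t)
    s∈M′ rewrite lookup-zipWith _+_ s (M -ₘ pre t) (post t)
               | lookup-zipWith _∸_ s M (pre t)
               | pre≡0 = ≤-trans s∈M (m≤m+n _ _)

  -- In the vertices of both games, nothing stands for ⊤ and just c for c.

  module PlainGame where

    Vertexᴳ : Set
    Vertexᴳ = Marking × Maybe Commitment

    data V₀ᴳ : Vertexᴳ → Set where
      v₀ : ∀ {M} → Reachable M → V₀ᴳ (M , nothing)

    data V₁ᴳ : Vertexᴳ → Set where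
      v₁ : ∀ {M c} (r : Reachable M) → c ⊆ sysPlace M r • → V₁ᴳ (M , just c)

    data Eᴳ : Vertexᴳ → Vertexᴳ → Set where
      E1 : ∀ {M c} (r : Reachable M) → c ⊆ sysPlace M r • →
           Eᴳ (M , nothing) (M , just c)
      E2 : ∀ {M c t M′} → V₁ᴳ (M , just c) → PurelyEnvironmental t → M [ t ⟩ M′ →
           Eᴳ (M , just c) (M′ , just c)
      E3 : ∀ {M c t M′} → V₁ᴳ (M , just c) → SystemTransition t → t ∈ c → M [ t ⟩ M′ →
           Eᴳ (M , just c) (M′ , nothing)

    data Xᴳ : Vertexᴳ → Set where
      bad-vertex : ∀ {M c} → V₁ᴳ (M , just c) → BadCondition M c → Xᴳ (M , just c)

    edge-vertices : ∀ {v w} → Eᴳ v w → (V₀ᴳ v ⊎ V₁ᴳ v) × (V₀ᴳ w ⊎ V₁ᴳ w)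
    edge-vertices (E1 r c⊆) = inj₁ (v₀ r) , inj₂ (v₁ r c⊆)
    edge-vertices (E2 (v₁ r c⊆) env f) = inj₂ (v₁ r c⊆) ,
      inj₂ (v₁ (fire r f) λ {t} t∈c → subst (_∈ₘ pre t) (sysPlace-stable r f env) (c⊆ t∈c))
    edge-vertices (E3 (v₁ r c⊆) _ _ f) = inj₂ (v₁ r c⊆) , inj₁ (v₀ (fire r f))

  module PrimedGame where

    Vertexᴳ : Set
    Vertexᴳ = Marking × Maybe Commitment × Multiset #places

    data V₀ᴳ : Vertexᴳ → Set where
      v₀ : ∀ {M} (r : Reachable M) → V₀ᴳ (M , nothing , ⁅ sysPlace M r ⁆ₘ)

    data V₁ᴳ : Vertexᴳ → Set where
      v₁ : ∀ {M c R} (r : Reachable M) → c ⊆ sysPlace M r • →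
           sysPlace M r ∈ₘ R → R ⊆ₘ M → V₁ᴳ (M , just c , R)

    data Eᴳ : Vertexᴳ → Vertexᴳ → Set where
      E1 : ∀ {M c} (r : Reachable M) → c ⊆ sysPlace M r • →
           Eᴳ (M , nothing , ⁅ sysPlace M r ⁆ₘ) (M , just c , ⁅ sysPlace M r ⁆ₘ)
      E2 : ∀ {M c R t M′ o} → V₁ᴳ (M , just c , R) → PurelyEnvironmental t → M [ t ⟩ M′ →
           o ∈ₘ post t →
           Eᴳ (M , just c , R) (M′ , just c , (R -ₘ pre t +ₘ ⁅ o ⁆ₘ))
      E3 : ∀ {M c R t M′} → V₁ᴳ (M , just c , R) → SystemTransition t → t ∈ c → M [ t ⟩ M′ →
           R ⊆ₘ pre t → (r′ : Reachable M′) →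
           Eᴳ (M , just c , R) (M′ , nothing , ⁅ sysPlace M′ r′ ⁆ₘ)

    data Xᴳ : Vertexᴳ → Set where
      bad-vertex : ∀ {M c R} → V₁ᴳ (M , just c , R) → BadCondition M c → Xᴳ (M , just c , R)

    edge-vertices : ∀ {v w} → Eᴳ v w → (V₀ᴳ v ⊎ V₁ᴳ v) × (V₀ᴳ w ⊎ V₁ᴳ w)
    edge-vertices (E1 {M} r c⊆) = inj₁ (v₀ r) ,
      inj₂ (v₁ r c⊆ (∈-singleton (sysPlace M r)) (singleton-⊆ M (proj₂ (theToken-∈ system M (one r)))))
    edge-vertices (E2 {M} {c} {R} {t} {o = o} v@(v₁ r c⊆ s∈R R⊆M) env f@(_ , refl) o∈post) = inj₂ v ,
      inj₂ (v₁ (fire r f) (λ {t} t∈c → subst (_∈ₘ pre t) s≡s′ (c⊆ t∈c))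
               (subst (_∈ₘ (R -ₘ pre t +ₘ ⁅ o ⁆ₘ)) s≡s′ s∈R′) R′⊆M′)
      where
      s = sysPlace M r
      s≡s′ = sysPlace-stable r f env
      pre≡0 : lookup (pre t) s ≡ 0
      pre≡0 = n≤0⇒n≡0 (≮⇒≥ λ s∈pre → env s s∈pre (proj₁ (theToken-∈ system M (one r))))
      s∈R′ : s ∈ₘ (R -ₘ pre t +ₘ ⁅ o ⁆ₘ)
      s∈R′ rewrite lookup-zipWith _+_ s (R -ₘ pre t) ⁅ o ⁆ₘ
                 | lookup-zipWith _∸_ s R (pre t)
                 | pre≡0 = ≤-trans s∈R (m≤m+n _ _)
      R′⊆M′ : (R -ₘ pre t +ₘ ⁅ o ⁆ₘ) ⊆ₘ (M -ₘ pre t +ₘ post t)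
      R′⊆M′ p rewrite lookup-zipWith _+_ p (R -ₘ pre t) ⁅ o ⁆ₘ
                    | lookup-zipWith _∸_ p R (pre t)
                    | lookup-zipWith _+_ p (M -ₘ pre t) (post t)
                    | lookup-zipWith _∸_ p M (pre t) =
        +-mono-≤ (∸-monoˡ-≤ (lookup (pre t) p) (R⊆M p)) (singleton-⊆ (post t) o∈post p)
    edge-vertices (E3 v _ _ _ _ r′) = inj₂ v , inj₁ (v₀ r′)

  Graph : GraphGame
  Graph = record
    { Vertex   = Vertexᴳ
    ; V₀       = V₀ᴳ
    ; V₁       = V₁ᴳ
    ; disjoint = λ { (v₀ _) () }
    ; I        = initial , nothing
    ; E        = Eᴳ
    ; X        = Xᴳ
    ; I⊆V      = inj₁ (v₀ start)
    ; E⊆V      = edge-vertices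
    ; X⊆V      = λ { (bad-vertex v _) → inj₂ v }
    }
    where open PlainGame

  Graph′ : GraphGame
  Graph′ = record
    { Vertex   = Vertexᴳ
    ; V₀       = V₀ᴳ
    ; V₁       = V₁ᴳ
    ; disjoint = λ { (v₀ _) () }
    ; I        = initial , nothing , ⁅ sysPlace initial start ⁆ₘ
    ; E        = Eᴳ
    ; X        = Xᴳ
    ; I⊆V      = inj₁ (v₀ start)
    ; E⊆V      = edge-vertices
    ; X⊆V      = λ { (bad-vertex v _) → inj₂ v }
    }
    where open PrimedGame

{-# OPTIONS --safe #-}
-- Forgetting R maps Graph′ to Graph; it preserves ownership, edges and bad
-- vertices, and the choices of Player 0 lift uniquely along it.  A strategy
-- therefore pulls back: a node of the new tree is a path in Graph′ together with
-- the node of the old tree that its projection reaches.  A play of Graph′ may stop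
-- where its projection goes on (E′3 has fewer edges than E3), so one needs that no
-- node of a winning strategy is bad, which holds because each node lies on a
-- maximal path.
module Submission where

open import Defs
open import Axiom.UniquenessOfIdentityProofs.WithK using (uip)
open import Data.Bool.Properties using () renaming (_≟_ to _≟ᵇ_)
open import Data.Fin using (Fin; zero; suc)
open import Data.Fin.Properties using (any?; all?)
open import Data.Fin.Subset using (⊥)
open import Data.Fin.Subset.Properties using (_∈?_; ∉⊥)
open import Data.Maybe using (just; nothing)
open import Data.Nat using (ℕ; zero; suc; _≟_; _≤?_; _<?_)
open import Data.Product using (Σ; _×_; _,_; proj₁; proj₂; ∃; ∃!)
open import Data.Sum using (inj₁; inj₂)
open import Data.Vec using (lookup)
open import Data.Vec.Properties using (≡-dec)
open import Function using (_∘_)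
open import Relation.Binary.PropositionalEquality using (_≡_; refl; sym; trans; cong; subst)
open import Relation.Nullary using (¬_; Dec; yes; no; contradiction)
open import Relation.Nullary.Decidable using (map′; _×-dec_; _→-dec_; ¬?; recompute)

-- Maximal paths of a relation.

module _ {A : Set} (R : A → A → Set) where

  cons : A → Sequence A → Sequence A
  cons a (finite n f) = finite (suc n) λ { zero → a ; (suc i) → f i }
  cons a (infinite f) = infinite λ { zero → a ; (suc i) → f i }

  cons-maximal : ∀ {a b} π → R a b → IsMaximalPath R b π → IsMaximalPath R a (cons a π)
  cons-maximal (finite n f) ab (refl , steps , stuck) =
    refl , (λ { zero → ab ; (suc i) → steps i }) , stuck
  cons-maximal (infinite f) ab (refl , steps) =
    refl , λ { zero → ab ; (suc i) → steps i }

  module _ (P : A → Set) where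

    AllMaximal : A → Set
    AllMaximal a = ∀ π → IsMaximalPath R a π → Allˢ P π

    Allˢ-cons⁻ : ∀ {a} π → Allˢ P (cons a π) → Allˢ P π
    Allˢ-cons⁻ (finite n f) all i = all (suc i)
    Allˢ-cons⁻ (infinite f) all i = all (suc i)

    AllMaximal-step : ∀ {a b} → R a b → AllMaximal a → AllMaximal b
    AllMaximal-step ab all π max = Allˢ-cons⁻ π (all (cons _ π) (cons-maximal π ab max))

    Allˢ-head : ∀ {a} π → IsMaximalPath R a π → Allˢ P π → P a
    Allˢ-head (finite n f) (refl , _) all = all zero
    Allˢ-head (infinite f) (refl , _) all = all 0

  module _ (successor? : ∀ a → Dec (∃ (R a))) where

    NoMaximal : A → Set
    NoMaximal a = ¬ ∃ (IsMaximalPath R a)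

    -- A stuck point is a maximal path by itself, and a maximal path from a successor could be
    -- prefixed with `a`.
    NoMaximal-step : ∀ {a} → NoMaximal a → ∃ λ b → R a b × NoMaximal b
    NoMaximal-step {a} none with successor? a
    ... | yes (b , ab) = b , ab , λ { (π , max) → none (cons a π , cons-maximal π ab max) }
    ... | no stuck     = contradiction (finite 0 (λ _ → a) , refl , (λ ()) , stuck) none

    -- Points without a maximal path would form an infinite, hence maximal, path.
    maximal-exists : ∀ a → ¬ NoMaximal a
    maximal-exists a none =
      none (infinite (proj₁ ∘ walk) , refl , proj₁ ∘ proj₂ ∘ NoMaximal-step ∘ proj₂ ∘ walk)
      where
      walk : ℕ → ∃ NoMaximal
      walk zero    = a , none
      walk (suc i) = let b , _ , none-b = NoMaximal-step (proj₂ (walk i)) in b , none-b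

-- Plays and safe nodes of a strategy tree.

module StrategyProperties {Γ : GraphGame} (σ : Strategy Γ) where
  open GraphGame Γ
  open Strategy σ

  label∈V : ∀ {n} (x : Node n) → V (label x)
  label∈V {zero}  x rewrite root-unique x | root-label = I⊆V
  label∈V {suc n} x = proj₂ (E⊆V (child-label {x = parent x} refl))

  -- Used contrapositively: a leaf of the tree carries a stuck vertex, so a finite maximal tree path
  -- is labelled with a maximal sequence of the game.
  successor⇒child : ∀ {n} (x : Node n) → ∃ (E (label x)) → ∃ ((n , x) ⟶_)
  successor⇒child x (w , e) with proj₁ (E⊆V e)
  ... | inj₁ x∈V₀ = let y , y↑x , _ = player0 x x∈V₀ (w , e) in _ , child y↑x
  ... | inj₂ x∈V₁ = let y , (y↑x , _) , _ = player1 x x∈V₁ w e in _ , child y↑x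

  ⟶⇒E : ∀ {x y} → x ⟶ y → E (labelAt x) (labelAt y)
  ⟶⇒E (child y↑x) = child-label y↑x

  maximal⇒play : ∀ π → IsMaximalTreePath π → IsPlay (mapˢ labelAt π)
  maximal⇒play (finite n f) (start , steps , stuck) =
    trans (cong labelAt start) root-label , ⟶⇒E ∘ steps , stuck ∘ successor⇒child _
  maximal⇒play (infinite f) (start , steps) =
    trans (cong labelAt start) root-label , ⟶⇒E ∘ steps

  module _ (successor? : ∀ {v} → V v → Dec (∃ (E v))) (winning : IsWinning Γ σ) where

    Safe : ∃ Node → Set
    Safe x = ¬ X (labelAt x)

    child? : ∀ x → Dec (∃ (x ⟶_))
    child? (n , x) =
      map′ (successor⇒child x) (λ { (y , xy) → labelAt y , ⟶⇒E xy }) (successor? (label∈V x))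

    Allˢ-map : ∀ π → Allˢ (¬_ ∘ X) (mapˢ labelAt π) → Allˢ Safe π
    Allˢ-map (finite n f) all = all
    Allˢ-map (infinite f) all = all

    -- Induction on the depth: at the root this is the winning condition, and a maximal path from
    -- `x` prefixed with its parent is a maximal path from the parent.
    paths-safe : ∀ {n} (x : Node n) → AllMaximal _⟶_ Safe (n , x)
    paths-safe {zero}  x rewrite root-unique x = λ π max → Allˢ-map π (proj₂ (winning π max))
    paths-safe {suc n} x = AllMaximal-step _⟶_ Safe (child refl) (paths-safe (parent x))

    -- `maximal-exists` only refutes the absence of a maximal path; this suffices because the goal
    -- is a negation.
    nodes-safe : ∀ {n} (x : Node n) → ¬ X (label x)
    nodes-safe x bad = maximal-exists _⟶_ child? (_ , x)
      λ { (π , max) → Allˢ-head _⟶_ Safe π max (paths-safe x π max) bad }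

-- Pulling a strategy back along a projection of graph games.

record Projection (Γ′ Γ : GraphGame) : Set where
  private
    module A = GraphGame Γ′
    module B = GraphGame Γ
  field
    proj    : A.Vertex → B.Vertex
    proj-I  : proj A.I ≡ B.I
    proj-V₀ : ∀ {v} → A.V₀ v → B.V₀ (proj v)
    proj-V₁ : ∀ {v} → A.V₁ v → B.V₁ (proj v)
    proj-E  : ∀ {v w} → A.E v w → B.E (proj v) (proj w)
    proj-X  : ∀ {v} → A.X v → B.X (proj v)
    -- Asked of Player 0 only: at a vertex of Player 1 an edge of `Graph` may have several lifts
    -- (`E2`, one for each `o`) or none (`E3`, when `R` is not contained in `pre t`).
    lift-E  : ∀ {v u} → A.V₀ v → B.E (proj v) u → ∃! _≡_ λ w → A.E v w × proj w ≡ u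

module Pullback {Γ′ Γ : GraphGame} (φ : Projection Γ′ Γ)
                (edge? : ∀ {v} → GraphGame.V Γ′ v → ∀ w → Dec (GraphGame.E Γ′ v w))
                (σ : Strategy Γ) where
  open Projection φ
  open GraphGame Γ′
  private
    module σ = Strategy σ

  -- The edge is irrelevant because siblings must be determined by their labels;
  -- decidability of edges recovers it.
  data History : ∀ {n} → σ.Node n → Vertex → Set where
    start : History σ.root I
    step  : ∀ {n} {y : σ.Node (suc n)} {v w} → History (σ.parent y) v →
            proj w ≡ σ.label y → .(E v w) → History y w

  Node : ℕ → Set
  Node n = Σ (σ.Node n) λ x → ∃ (History x)

  label : ∀ {n} → Node n → Vertex
  label (_ , v , _) = v

  parent : ∀ {n} → Node (suc n) → Node n
  parent (y , _ , step h _ _) = σ.parent y , _ , h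

  label-proj : ∀ {n} {x : σ.Node n} {v} → History x v → proj v ≡ σ.label x
  label-proj start        = trans proj-I (sym σ.root-label)
  label-proj (step _ p _) = p

  -- `edge?` applies only to edges out of vertices of the game, so recovering the last edge needs
  -- the claim for the shorter history.
  label∈V : ∀ {n} {x : σ.Node n} {v} → History x v → V v
  label∈V start        = I⊆V
  label∈V (step h _ e) = proj₂ (E⊆V (recompute (edge? (label∈V h) _) e))

  child-label : ∀ {n} {x : Node n} {y : Node (suc n)} → parent y ≡ x → E (label x) (label y)
  child-label {y = _ , w , step h _ e} refl = recompute (edge? (label∈V h) w) e

  root-unique : (x : Node 0) → x ≡ (σ.root , I , start)
  root-unique (_ , _ , start) = refl

  -- Besides the old node and the label, a child holds only an irrelevant edge and an equation of
  -- vertices, which `uip` makes unique.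
  unique-child : ∀ {n} {x : σ.Node n} {v w} (h : History x v) (y : σ.Node (suc n)) →
                 σ.parent y ≡ x → proj w ≡ σ.label y → E v w →
                 Σ (Node (suc n)) λ z → (parent z ≡ (x , v , h) × label z ≡ w) ×
                   (∀ {z′} → parent z′ ≡ (x , v , h) → proj₁ z′ ≡ y → label z′ ≡ w → z ≡ z′)
  unique-child h y refl p e = (y , _ , step h p e) , (refl , refl) , unique
    where
    unique : ∀ {z′} → parent z′ ≡ (σ.parent y , _ , h) → proj₁ z′ ≡ y → label z′ ≡ _ →
             (y , _ , step h p e) ≡ z′
    unique {_ , _ , step _ p′ _} refl refl refl = cong (λ q → y , _ , step h q e) (uip p p′)

  player1 : ∀ {n} (x : Node n) → V₁ (label x) → ∀ w → E (label x) w →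
            ∃! _≡_ λ y → parent y ≡ x × label y ≡ w
  player1 (x , v , h) v∈V₁ w e
    with σ.player1 x (subst (GraphGame.V₁ Γ) (label-proj h) (proj-V₁ v∈V₁)) (proj w)
           (subst (λ u → GraphGame.E Γ u (proj w)) (label-proj h) (proj-E e))
  ... | y , (y↑x , y≡w) , unique-y with unique-child h y y↑x (sym y≡w) e
  ... | z , z-child , unique-z = z , z-child , unique
    where
    unique : ∀ {z′} → parent z′ ≡ (x , v , h) × label z′ ≡ w → z ≡ z′
    -- The old node under `z′` has label `proj w`, so uniqueness in `σ` identifies it with `y`.
    unique {_ , _ , step _ p _} (refl , refl) = unique-z refl (sym (unique-y (refl , sym p))) refl

  player0 : ∀ {n} (x : Node n) → V₀ (label x) → ∃ (E (label x)) → ∃! _≡_ λ y → parent y ≡ x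
  player0 (x , v , h) v∈V₀ (w′ , e′)
    with σ.player0 x (subst (GraphGame.V₀ Γ) (label-proj h) (proj-V₀ v∈V₀))
           (proj w′ , subst (λ u → GraphGame.E Γ u (proj w′)) (label-proj h) (proj-E e′))
  ... | y , y↑x , unique-y
    with lift-E v∈V₀ (subst (λ u → GraphGame.E Γ u (σ.label y)) (sym (label-proj h))
                            (σ.child-label y↑x))
  ... | w , (e , w≡y) , unique-w with unique-child h y y↑x w≡y e
  ... | z , (z↑x , _) , unique-z = z , z↑x , unique
    where
    unique : ∀ {z′} → parent z′ ≡ (x , v , h) → z ≡ z′
    -- First the old nodes agree, by uniqueness in `σ`; then both labels lift the same edge, so
    -- `lift-E` identifies them.
    unique {z′@(y′ , _ , step _ p _)} z′↑x@refl = unique-z z′↑x (sym y≡y′)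
      (sym (unique-w (child-label {y = z′} z′↑x , trans p (cong σ.label (sym y≡y′)))))
      where
      y≡y′ : y ≡ y′
      y≡y′ = unique-y refl

  pullback : Strategy Γ′
  pullback = record
    { tree = record
      { Node = Node ; root = σ.root , I , start ; root-unique = root-unique
      ; parent = parent ; label = label }
    ; root-label  = refl
    ; child-label = child-label
    ; player1     = player1
    ; player0     = player0
    }

  -- Only safety is left to show, since `maximal⇒play` holds for every strategy; a bad label would
  -- project to a bad label of `σ`.
  pullback-winning : (∀ {v} → GraphGame.V Γ v → Dec (∃ (GraphGame.E Γ v))) →
                     IsWinning Γ σ → IsWinning Γ′ pullback
  pullback-winning successor? winning π max = maximal⇒play π max , safe π
    where
    open StrategyProperties pullback using (maximal⇒play)
    open Strategy pullback using (labelAt)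
    node-safe : ∀ x → ¬ X (labelAt x)
    node-safe (_ , x , _ , h) bad = StrategyProperties.nodes-safe σ successor? winning x
      (subst (GraphGame.X Γ) (label-proj h) (proj-X bad))
    safe : ∀ π → WonByPlayer0 (mapˢ labelAt π)
    safe (finite n f) i = node-safe (f i)
    safe (infinite f) i = node-safe (f i)

-- Decidability in the two Petri graph games, and the projection forgetting `R`.

_∈ₘ?_ : ∀ {n} (p : Fin n) (M : Multiset n) → Dec (p ∈ₘ M)
p ∈ₘ? M = 0 <? lookup M p

_⊆ₘ?_ : ∀ {n} (M M′ : Multiset n) → Dec (M ⊆ₘ M′)
M ⊆ₘ? M′ = all? λ p → lookup M p ≤? lookup M′ p

_≟ₘ_ : ∀ {n} (M M′ : Multiset n) → Dec (M ≡ M′)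
_≟ₘ_ = ≡-dec _≟_

module _ (G : PetriGame) (one : PetriGame.OneSystemPlayer G) where
  open PetriGame G
  private
    module P = PlainGame G one
    module Q = PrimedGame G one

  environmental? : ∀ t → Dec (PurelyEnvironmental t)
  environmental? t = all? λ p → (p ∈ₘ? pre t) →-dec ¬? (p ∈? system)

  fires? : ∀ M t M′ → Dec (M [ t ⟩ M′)
  fires? M t M′ = (pre t ⊆ₘ? M) ×-dec (M′ ≟ₘ _)

  successor? : ∀ {v} → GraphGame.V (Graph G one) v → Dec (∃ (P.Eᴳ v))
  -- The empty commitment is always allowed.
  successor? (inj₁ (P.v₀ r)) = yes (_ , P.E1 {c = ⊥} r λ t∈⊥ → contradiction t∈⊥ ∉⊥)
  successor? {M , just c} (inj₂ v)
    with any? (λ t → environmental? t ×-dec (pre t ⊆ₘ? M))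
  ... | yes (t , env , en) = yes (_ , P.E2 v env (en , refl))
  ... | no ¬env with any? (λ t → ¬? (environmental? t) ×-dec (t ∈? c) ×-dec (pre t ⊆ₘ? M))
  ...   | yes (t , sys , t∈c , en) = yes (_ , P.E3 v sys t∈c (en , refl))
  ...   | no ¬sys = no λ where
    (_ , P.E2 _ env (en , _))     → ¬env (_ , env , en)
    (_ , P.E3 _ sys t∈c (en , _)) → ¬sys (_ , sys , t∈c , en)

  -- With `R` and `R′` variables, matching on `E1` is plain substitution; the lemma is then applied
  -- where `R` is already a singleton.
  E1-inversion : ∀ {M M′ c R R′} → Q.Eᴳ (M , nothing , R) (M′ , just c , R′) →
                 M′ ≡ M × R′ ≡ R × Σ (Reachable M) λ r → _⊆_• G one c (sysPlace G one M r)
  E1-inversion (Q.E1 r c⊆) = refl , refl , r , c⊆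

  edge? : ∀ {v} → GraphGame.V (Graph′ G one) v → ∀ w → Dec (Q.Eᴳ v w)
  edge? (inj₁ (Q.v₀ r)) (M′ , nothing , R′) = no λ ()
  edge? (inj₁ (Q.v₀ {M} r)) (M′ , just c , R′) =
    map′ (λ { (refl , refl , c⊆) → Q.E1 r λ {t} → c⊆ t })
         (λ e → let M′≡M , R′≡R , _ , c⊆ = E1-inversion e in M′≡M , R′≡R , λ t → c⊆)
         ((M′ ≟ₘ M) ×-dec (R′ ≟ₘ _) ×-dec
           (all? λ t → (t ∈? c) →-dec (sysPlace G one M r ∈ₘ? pre t)))
  edge? {M , just c , R} (inj₂ v) (M′ , just c′ , R′) =
    map′ (λ { (refl , t , env , f , o , o∈post , refl) → Q.E2 v env f o∈post })
         (λ { (Q.E2 _ env f o∈post) → refl , _ , env , f , _ , o∈post , refl })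
         (≡-dec _≟ᵇ_ c c′ ×-dec any? λ t → environmental? t ×-dec fires? M t M′ ×-dec
           any? λ o → (o ∈ₘ? post t) ×-dec (R′ ≟ₘ (R -ₘ pre t +ₘ ⁅ o ⁆ₘ)))
  edge? {M , just c , R} (inj₂ v@(Q.v₁ r _ _ _)) (M′ , nothing , R′)
    with any? (λ t → ¬? (environmental? t) ×-dec (t ∈? c) ×-dec fires? M t M′ ×-dec (R ⊆ₘ? pre t))
  ... | no ¬sys = no λ { (Q.E3 _ sys t∈c f R⊆ _) → ¬sys (_ , sys , t∈c , f , R⊆) }
  -- One witness `t` decides all cases: the target depends only on `M′`, as `sysPlace` ignores the
  -- reachability proof.
  ... | yes (t , sys , t∈c , f , R⊆) =
    map′ (λ { refl → Q.E3 v sys t∈c f R⊆ (fire r f) }) (λ { (Q.E3 _ _ _ _ _ _) → refl })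
         (R′ ≟ₘ ⁅ sysPlace G one M′ (fire r f) ⁆ₘ)

  -- Gives the uniqueness in `lift-E`: `E1` keeps `M` and `R`, so Player 0 chooses nothing but the
  -- commitment.
  E-determined : ∀ {M R w w′} → Q.Eᴳ (M , nothing , R) w → Q.Eᴳ (M , nothing , R) w′ →
                 proj₁ (proj₂ w) ≡ proj₁ (proj₂ w′) → w ≡ w′
  E-determined (Q.E1 _ _) e refl with refl , refl , _ ← E1-inversion e = refl

  forget : Projection (Graph′ G one) (Graph G one)
  forget = record
    { proj    = λ { (M , c , _) → M , c }
    ; proj-I  = refl
    ; proj-V₀ = λ { (Q.v₀ r) → P.v₀ r }
    ; proj-V₁ = plain-V₁
    ; proj-E  = λ where
        (Q.E1 r c⊆)            → P.E1 r c⊆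
        (Q.E2 v env f _)       → P.E2 (plain-V₁ v) env f
        (Q.E3 v sys t∈c f _ _) → P.E3 (plain-V₁ v) sys t∈c f
    ; proj-X  = λ { (Q.bad-vertex v b) → P.bad-vertex (plain-V₁ v) b }
    ; lift-E  = λ { (Q.v₀ _) (P.E1 r c⊆) → _ , (Q.E1 r c⊆ , refl) ,
                  λ { (e , eq) → E-determined (Q.E1 r c⊆) e (cong proj₂ (sym eq)) } }
    }
    where
    plain-V₁ : ∀ {M c R} → Q.V₁ᴳ (M , c , R) → P.V₁ᴳ (M , c)
    plain-V₁ (Q.v₁ r c⊆ _ _) = P.v₁ r c⊆

theorem2 : (G : PetriGame) (one : PetriGame.OneSystemPlayer G) → PetriGame.Bounded G →
    Player0HasWinningStrategy (Graph G one) → Player0HasWinningStrategy (Graph′ G one)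
theorem2 G one _ (σ , winning) = pullback , pullback-winning (successor? G one) winning
  where open Pullback (forget G one) (edge? G one) σ
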